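{- Let $G=(V,E)$ be a finite simple undirected graph and let $\kappa$ be a positive integer. Let $C\in C(A)$ be such that $|C|=\kappa$ and let $\{v_1,v_2,\ldots,v_\kappa\}$ be its vertex set. Suppose in addition that $\{r_1,r_2,\ldots,r_\kappa\}\subset V$ and $A'=\{e_1,e_2,\ldots,e_\kappa\}\subset A$ exist such that: (i) $\{r_1,r_2,\ldots,r_\kappa\}\cap\{v_1,v_2,\ldots,v_\kappa\}=\emptyset$; (ii) either $e_k=(r_k,v_k)$ for all $1\le k\le\kappa$, or $e_k=(v_k,r_k)$ for all $1\le k\le\kappa$. Then the inequality \[\sum_{(i,j)\in C}\left(\lfloor\kappa/2\rfloor w_{ij}+w_{ji}\right)+\sum_{(i,j)\in A'} w_{ij}-\kappa\le\lfloor\kappa/2\rfloor z\] is valid for $P_{G,\kappa}$.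
   Context: Let $m=|E|$. Let $D=(V,A)$ be the directed graph with $A=\{(i,j),(j,i)\mid [i,j]\in E\}$. Paths are directed and elementary (no repeated vertices); paths and cycles are identified with their arc sets. $P_\kappa(A)$ denotes the set of all paths in $D$ with exactly $\kappa$ arcs, and $C(A)$ the set of all directed (elementary) cycles in $D$ (including those of length 2), with $|C|$ the number of arcs of $C$. The polytope $P_{G,\kappa}$ is the convex hull of all $(w,z)\in\mathbb{R}^{2m}\times\mathbb{R}$, $w=(w_{ij})_{(i,j)\in A}$, satisfying (1) $w_{ij}+w_{ji}\le 1$ for all $[i,j]\in E$; (2) $\sum_{(i,j)\in C}w_{ij}\le |C|-1$ for all $C\in C(A)$; (3) $\sum_{(i,j)\in p}w_{ij}\le z$ for all $p\in P_\kappa(A)$; (4) $w_{ij}\in\{0,1\}$ for all $(i,j)\in A$; (5) $0\le z\le\kappa$. An inequality is valid for $P_{G,\kappa}$ if every point of $P_{G,\kappa}$ satisfies it. -}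

module Defs where

open import Algebra.Bundles using (CommutativeRing; Semiring)
open import Algebra.Structures using (IsCommutativeRing)
import Algebra.Definitions.RawSemiring as RawSemiringDefinitions
open import Data.Fin using (Fin; toℕ; inject₁) renaming (suc to fsuc)
open import Data.Nat using (ℕ; suc; NonZero)
open import Data.Nat.DivMod using (_mod_)
open import Data.Product using (∃; ∃-syntax; _×_)
open import Data.Sum using (_⊎_)
open import Function.Bundles using (_⇔_)
open import Function.Definitions using (Injective)
open import Level using (Level; _⊔_; 0ℓ) renaming (suc to lsuc)
open import Relation.Binary.Core using (Rel)
open import Relation.Binary.Definitions using (Symmetric; Decidable)
open import Relation.Binary.PropositionalEquality using (_≡_)
open import Relation.Binary.Structures using (IsTotalOrder)
open import Relation.Nullary using (¬_)
open import Relation.Unary using (Pred)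

-- The real numbers are characterised, up to isomorphism, as a
-- Dedekind-complete totally ordered field.
record Reals (c ℓ₁ ℓ₂ : Level) : Set (lsuc (c ⊔ ℓ₁ ⊔ ℓ₂)) where
  infix  4 _≈_ _≤_
  infixl 6 _+_
  infixl 7 _*_
  infix  8 -_
  field
    Carrier           : Set c
    _≈_               : Rel Carrier ℓ₁
    _≤_               : Rel Carrier ℓ₂
    _+_ _*_           : Carrier → Carrier → Carrier
    -_                : Carrier → Carrier
    0# 1#             : Carrier
    isCommutativeRing : IsCommutativeRing _≈_ _+_ _*_ -_ 0# 1#
    0≉1               : ¬ (0# ≈ 1#)
    inverse           : ∀ x → ¬ (x ≈ 0#) → ∃[ y ] x * y ≈ 1#
    isTotalOrder      : IsTotalOrder _≈_ _≤_
    +-monoʳ-≤         : ∀ x {y z} → y ≤ z → x + y ≤ x + z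
    *-nonNegative     : ∀ {x y} → 0# ≤ x → 0# ≤ y → 0# ≤ x * y

  UpperBound : Pred Carrier (c ⊔ ℓ₁ ⊔ ℓ₂) → Pred Carrier (c ⊔ ℓ₁ ⊔ ℓ₂)
  UpperBound P b = ∀ x → P x → x ≤ b

  field
    complete : (P : Pred Carrier (c ⊔ ℓ₁ ⊔ ℓ₂)) → ∃ P → ∃ (UpperBound P) →
               ∃[ s ] (UpperBound P s × (∀ b → UpperBound P b → s ≤ b))

  commutativeRing : CommutativeRing c ℓ₁
  commutativeRing = record { isCommutativeRing = isCommutativeRing }

  open CommutativeRing commutativeRing public using (_-_)
  open RawSemiringDefinitions (Semiring.rawSemiring (CommutativeRing.semiring commutativeRing)) public
    using (sum) renaming (_×_ to _·_)

  fromℕ : ℕ → Carrier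
  fromℕ n = n · 1#

record SimpleGraph : Set₁ where
  infix 4 _~_ _~?_
  field
    order  : ℕ
    _~_    : Rel (Fin order) 0ℓ
    _~?_   : Decidable _~_
    ~-sym  : Symmetric _~_
    ~-irr  : ∀ i → ¬ (i ~ i)

  V : Set
  V = Fin order

module Digraph (G : SimpleGraph) where
  open SimpleGraph G

  -- The adjacency proof is irrelevant, so an arc is determined by its
  -- endpoints.
  record Arc : Set where
    constructor arc
    field
      tail head : V
      .adjacent : tail ~ head

  open Arc public

  reverse : Arc → Arc
  reverse (arc i j i~j) = arc j i (~-sym i~j)

  _isArc_⟶_ : Arc → V → V → Set
  a isArc i ⟶ j = tail a ≡ i × head a ≡ j

  record Path (k : ℕ) : Set where
    field
      vertex    : Fin (suc k) → V
      injective : Injective _≡_ _≡_ vertex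
      step      : ∀ t → vertex (inject₁ t) ~ vertex (fsuc t)

    arcs : Fin k → Arc
    arcs t = arc (vertex (inject₁ t)) (vertex (fsuc t)) (step t)

  next : ∀ {k} .{{_ : NonZero k}} → Fin k → Fin k
  next {k} t = suc (toℕ t) mod k

  -- No cycle has k = 1, since _~_ is irreflexive; k = 2 is allowed.
  record Cycle (k : ℕ) .{{_ : NonZero k}} : Set where
    field
      vertex    : Fin k → V
      injective : Injective _≡_ _≡_ vertex
      step      : ∀ t → vertex t ~ vertex (next t)

    arcs : Fin k → Arc
    arcs t = arc (vertex t) (vertex (next t)) (step t)

  -- v lists the vertex set of C, not necessarily in cyclic order.
  _Enumerates_ : ∀ {k} .{{_ : NonZero k}} → (Fin k → V) → Cycle k → Set
  v Enumerates C =
    Injective _≡_ _≡_ v × (∀ u → (∃[ k ] v k ≡ u) ⇔ (∃[ t ] Cycle.vertex C t ≡ u))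

module Polytope {c ℓ₁ ℓ₂} (ℝ : Reals c ℓ₁ ℓ₂) (G : SimpleGraph) where
  open Reals ℝ
  open Digraph G

  record Point : Set c where
    field
      w : Arc → Carrier
      z : Carrier

  open Point public

  record ConvexHull {ℓ} (S : Pred Point ℓ) (x : Point) : Set (c ⊔ ℓ₁ ⊔ ℓ₂ ⊔ ℓ) where
    field
      size        : ℕ
      weight      : Fin size → Carrier
      point       : Fin size → Point
      nonNegative : ∀ t → 0# ≤ weight t
      sum≈1       : sum weight ≈ 1#
      point∈S     : ∀ t → S (point t)
      w-combines  : ∀ a → w x a ≈ sum (λ t → weight t * w (point t) a)
      z-combines  : z x ≈ sum (λ t → weight t * z (point t))

  record Feasible (κ : ℕ) (x : Point) : Set (c ⊔ ℓ₁ ⊔ ℓ₂) where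
    field
      edge≤1 : ∀ a → w x a + w x (reverse a) ≤ 1#
      cycle≤ : ∀ {k} .{{_ : NonZero k}} (C : Cycle k) →
               sum (λ t → w x (Cycle.arcs C t)) ≤ fromℕ k - 1#
      path≤z : (p : Path κ) → sum (λ t → w x (Path.arcs p t)) ≤ z x
      binary : ∀ a → w x a ≈ 0# ⊎ w x a ≈ 1#
      0≤z    : 0# ≤ z x
      z≤κ    : z x ≤ fromℕ κ

  P : ℕ → Pred Point (c ⊔ ℓ₁ ⊔ ℓ₂)
  P κ = ConvexHull (Feasible κ)

  Valid : ℕ → (lhs rhs : Point → Carrier) → Set (c ⊔ ℓ₁ ⊔ ℓ₂)
  Valid κ lhs rhs = ∀ x → P κ x → lhs x ≤ rhs x

{-# OPTIONS --safe #-}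

-- Both sides are affine, so it suffices to treat feasible points, where the w-values are
-- bits and everything can be counted in ℕ. Let h = ⌊κ/2⌋, let X and Y be the weights of C
-- and of its reversal, and U that of A'; then X + Y ≤ κ. Omitting an arc from C (or from
-- its reversal) leaves a path with κ − 1 arcs, and the arc of A' at one of its ends extends
-- it to a path with κ arcs. Hence X − x_s + u_s ≤ z and Y − y_s + v_s ≤ z for all s, where
-- u and v both sum to U.
-- If u ≤ x pointwise then U ≤ X, and z ≥ X (or U = Y = 0 and z ≥ X − 1) is enough. Otherwise
-- z ≥ X + 1, which is enough unless Y + U > h + κ. In that case Y > h, and the bound on z
-- obtained from the reversed cycle is enough.
module Submission where

open import Defs
open import Data.Fin using (Fin)
open import Data.Nat using (ℕ; NonZero; ⌊_/2⌋)
open import Data.Sum using (_⊎_)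
open import Relation.Binary.PropositionalEquality using (_≢_)

open import Algebra.Bundles using (CommutativeRing)
import Algebra.Properties.CommutativeSemigroup as CommutativeSemigroupProperties
import Algebra.Properties.Ring as RingProperties
import Algebra.Properties.Semiring.Mult as SemiringMult
import Algebra.Properties.Semiring.Sum as SemiringSum
open import Data.Fin using (zero; suc; toℕ; inject₁; opposite)
open import Data.Fin.Permutation using (Permutation′; permutation; _⟨$⟩ʳ_; _⟨$⟩ˡ_; inverseˡ)
  renaming (reverse to opposite-permutation)
open import Data.Fin.Properties using (any?; toℕ-injective; toℕ-fromℕ; toℕ-fromℕ<; toℕ-inject₁; toℕ<n)
import Data.Nat as ℕ
open import Data.Nat using (zero; suc; z≤n; s≤s)
import Data.Nat.Properties as ℕ
open import Data.Nat.Tactic.RingSolver using (solve-∀)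
open import Data.Product using (∃-syntax; _×_; _,_; proj₁; proj₂)
open import Data.Sum using (inj₁; inj₂)
open import Function using (_∘_)
open import Function.Bundles using (Equivalence)
open import Function.Definitions using (Injective)
open import Relation.Binary.Bundles using (Poset)
open import Relation.Binary.PropositionalEquality as ≡ using (_≡_)
import Relation.Binary.Reasoning.PartialOrder as PosetReasoning
open import Relation.Binary.Structures using (IsTotalOrder)
open import Relation.Nullary using (¬_; yes; no; recompute; contradiction; contradiction-irr)

module ℕΣ = SemiringSum ℕ.+-*-semiring

module _ where
  open import Data.Fin using (fromℕ)
  open import Data.Nat hiding (zero; suc)
  open import Data.Nat.DivMod
  open import Data.Nat.Properties
  open CommutativeSemigroupProperties +-commutativeSemigroup using (x∙yz≈y∙xz; xy∙z≈y∙xz)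
  open ≡
  open ℕΣ using (sum)

  -- Finite sums and inequalities in ℕ.

  sum-mono-≤ : ∀ {n} {f g : Fin n → ℕ} → (∀ i → f i ≤ g i) → sum f ≤ sum g
  sum-mono-≤ {zero}  f≤g = z≤n
  sum-mono-≤ {suc n} f≤g = +-mono-≤ (f≤g zero) (sum-mono-≤ (f≤g ∘ suc))

  sum-≤1 : ∀ {n} {f : Fin n → ℕ} → (∀ i → f i ≤ 1) → sum f ≤ n
  sum-≤1 {zero}  f≤1 = z≤n
  sum-≤1 {suc n} f≤1 = +-mono-≤ (f≤1 zero) (sum-≤1 (f≤1 ∘ suc))

  sum-suc : ∀ {n} (f : Fin n → ℕ) → sum (suc ∘ f) ≡ n + sum f
  sum-suc {zero}  f = refl
  sum-suc {suc n} f = cong suc (begin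
    f zero + sum (suc ∘ f ∘ suc)  ≡⟨ cong (f zero +_) (sum-suc (f ∘ suc)) ⟩
    f zero + (n + sum (f ∘ suc))  ≡⟨ x∙yz≈y∙xz (f zero) n _ ⟩
    n + (f zero + sum (f ∘ suc))  ∎)
    where open ≡-Reasoning

  ∃<-or-sum≥ : ∀ {n} (f g : Fin n → ℕ) → (∃[ i ] f i < g i) ⊎ sum g ≤ sum f
  ∃<-or-sum≥ f g with any? (λ i → f i <? g i)
  ... | yes i∶f<g = inj₁ i∶f<g
  ... | no  ∄f<g  = inj₂ (sum-mono-≤ λ i → ≮⇒≥ λ f<g → ∄f<g (i , f<g))

  -- If `f` exceeds `g` at every index, integrality makes each gap at least 1, so the gaps total at
  -- least `n`. This is the previous dichotomy applied to `suc ∘ g`.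
  ∃≤-or-sum> : ∀ {n} (f g : Fin n → ℕ) → (∃[ i ] f i ≤ g i) ⊎ n + sum g ≤ sum f
  ∃≤-or-sum> f g with ∃<-or-sum≥ f (suc ∘ g)
  ... | inj₁ (i , f<1+g) = inj₁ (i , s≤s⁻¹ f<1+g)
  ... | inj₂ Σ≤          = inj₂ (subst (_≤ sum f) (sum-suc g) Σ≤)

  -- Used with `b` the weight of the omitted arc and `c` that of the added arc: trading `b` for `c`
  -- gains at least `d` over the total `a`.
  exchange-≤ : ∀ {n a} d {b c} → n + b ≡ a + c → d + b ≤ c → a + d ≤ n
  exchange-≤ {n} {a} d {b} {c} eq d+b≤c = +-cancelʳ-≤ b (a + d) n (begin
    a + d + b    ≡⟨ +-assoc a d b ⟩
    a + (d + b)  ≤⟨ +-monoʳ-≤ a d+b≤c ⟩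
    a + c        ≡⟨ eq ⟨
    n + b        ∎)
    where open ≤-Reasoning

  n≤1+⌊n/2⌋+⌊n/2⌋ : ∀ n → n ≤ 1 + ⌊ n /2⌋ + ⌊ n /2⌋
  n≤1+⌊n/2⌋+⌊n/2⌋ zero          = z≤n
  n≤1+⌊n/2⌋+⌊n/2⌋ (suc zero)    = ≤-refl
  n≤1+⌊n/2⌋+⌊n/2⌋ (suc (suc n)) = s≤s (subst (suc n ≤_) (sym (+-suc (suc ⌊ n /2⌋) ⌊ n /2⌋))
                                      (s≤s (n≤1+⌊n/2⌋+⌊n/2⌋ n)))

  -- The counting argument for one cycle.

  -- x and y are the weights of the arcs of the cycle and of their reversals, u and v those
  -- of the added arcs, indexed so that the Hamiltonian path of the cycle that omits the arc
  -- s (or its reversal) can be extended by the arc weighted by u s (or v s).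
  module Counting {m} (x y u v : Fin (suc m) → ℕ)
    (2≤κ : 2 ≤ suc m) (x+y≤1 : ∀ s → x s + y s ≤ 1) (u≤1 : ∀ s → u s ≤ 1) (Σu≡Σv : sum u ≡ sum v)
    {b} (B : ℕ → Set b)
    (forward  : ∀ s → ∃[ n ] B n × n + x s ≡ sum x + u s)
    (backward : ∀ s → ∃[ n ] B n × n + y s ≡ sum y + v s)
    where

    open ≤-Reasoning

    κ h X Y U : ℕ
    κ = suc m
    h = ⌊ κ /2⌋
    X = sum x
    Y = sum y
    U = sum u

    1≤h : 1 ≤ h
    1≤h = ⌊n/2⌋-mono 2≤κ

    X+Y≤κ : X + Y ≤ κ
    X+Y≤κ = subst (_≤ κ) (ℕΣ.∑-distrib-+ x y) (sum-≤1 x+y≤1)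

    U≤κ : U ≤ κ
    U≤κ = sum-≤1 u≤1

    -- The target inequality with `κ` moved to the right and `z` replaced by a number `n` satisfying
    -- `B`. Later `B n` says that `n` is at most `z`, so the count itself never mentions real
    -- numbers.
    Reached : Set b
    Reached = ∃[ n ] B n × h * X + (Y + U) ≤ h * n + κ

    -- Each unit by which `n` exceeds `X` contributes `h` on the right, so an excess of `d` leaves
    -- only `Y + U` to be compared with `h * d + κ`.
    reach : ∀ {n} d → B n → X + d ≤ n → Y + U ≤ h * d + κ → Reached
    reach {n} d Bn X+d≤n Y+U≤ = n , Bn , (begin
      h * X + (Y + U)      ≤⟨ +-monoʳ-≤ (h * X) Y+U≤ ⟩
      h * X + (h * d + κ)  ≡⟨ +-assoc (h * X) _ _ ⟨
      h * X + h * d + κ    ≡⟨ cong (_+ κ) (*-distribˡ-+ h X d) ⟨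
      h * (X + d) + κ      ≤⟨ +-monoˡ-≤ κ (*-monoʳ-≤ h X+d≤n) ⟩
      h * n + κ            ∎)

    U≤X⇒reached : U ≤ X → Reached
    U≤X⇒reached U≤X with ∃≤-or-sum> x u
    ... | inj₁ (s , x≤u) with n , Bn , eq ← forward s =
      reach 0 Bn (exchange-≤ 0 eq x≤u) (begin
        Y + U      ≤⟨ +-monoʳ-≤ Y U≤X ⟩
        Y + X      ≡⟨ +-comm Y X ⟩
        X + Y      ≤⟨ X+Y≤κ ⟩
        κ          ≤⟨ m≤n+m κ (h * 0) ⟩
        h * 0 + κ  ∎)
    ... | inj₂ κ+U≤X with n , Bn , eq ← forward zero = n , Bn , (begin
      h * X + (Y + U)  ≤⟨ +-mono-≤ (*-monoʳ-≤ h X≤1+n) Y+U≤0 ⟩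
      h * suc n + 0    ≡⟨ +-identityʳ _ ⟩
      h * suc n        ≡⟨ *-suc h n ⟩
      h + h * n        ≡⟨ +-comm h _ ⟩
      h * n + h        ≤⟨ +-monoʳ-≤ (h * n) (⌊n/2⌋≤n κ) ⟩
      h * n + κ        ∎)
      where
      X≤1+n : X ≤ suc n
      X≤1+n = begin
        X           ≤⟨ m≤m+n X _ ⟩
        X + u zero  ≡⟨ eq ⟨
        n + x zero  ≤⟨ +-monoʳ-≤ n (≤-trans (m≤m+n _ _) (x+y≤1 zero)) ⟩
        n + 1       ≡⟨ +-comm n 1 ⟩
        suc n       ∎
      Y+U≤0 : Y + U ≤ 0
      Y+U≤0 = +-cancelˡ-≤ κ (Y + U) 0 (begin
        κ + (Y + U)  ≡⟨ cong (κ +_) (+-comm Y U) ⟩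
        κ + (U + Y)  ≡⟨ +-assoc κ U Y ⟨
        κ + U + Y    ≤⟨ +-monoˡ-≤ Y κ+U≤X ⟩
        X + Y        ≤⟨ X+Y≤κ ⟩
        κ            ≡⟨ +-identityʳ κ ⟨
        κ + 0        ∎)

    -- For either parity `κ ≤ 2h + 1`, so whatever `Y` has beyond `h + 1` is missing from `X`
    -- relative to `h`.
    X+j≤h : ∀ j → suc h + j ≡ Y → X + j ≤ h
    X+j≤h j eq = +-cancelˡ-≤ (suc h) (X + j) h (begin
      suc h + (X + j)  ≡⟨ x∙yz≈y∙xz (suc h) X j ⟩
      X + (suc h + j)  ≡⟨ cong (X +_) eq ⟩
      X + Y            ≤⟨ X+Y≤κ ⟩
      κ                ≤⟨ n≤1+⌊n/2⌋+⌊n/2⌋ κ ⟩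
      suc h + h        ∎)

    h+κ<Y+U⇒h<Y : h + κ < Y + U → h < Y
    h+κ<Y+U⇒h<Y h+κ<Y+U = +-cancelʳ-< κ h Y (<-≤-trans h+κ<Y+U (+-monoʳ-≤ Y U≤κ))

    h+κ<Y+U⇒reached : h + κ < Y + U → Reached
    h+κ<Y+U⇒reached h+κ<Y+U with h<Y ← h+κ<Y+U⇒h<Y h+κ<Y+U
      with j , eq ← m≤n⇒∃[o]m+o≡n h<Y | ∃<-or-sum≥ y v
    ... | inj₁ (s , y<v) with n , Bn , eq′ ← backward s = reach (2 + 2 * j) Bn
      -- 2 + 2j is a lower bound for (Y + 1) − X, since Y = h + 1 + j and X ≤ h − j.
      (begin
        X + (2 + 2 * j)    ≡⟨ regroup₁ X j ⟩
        X + j + (2 + j)    ≤⟨ +-monoˡ-≤ (2 + j) (X+j≤h j eq) ⟩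
        h + (2 + j)        ≡⟨ regroup₂ h j ⟩
        suc h + j + 1      ≡⟨ cong (_+ 1) eq ⟩
        Y + 1              ≤⟨ exchange-≤ 1 eq′ y<v ⟩
        n                  ∎)
      (begin
        Y + U                                ≡⟨ cong (_+ U) eq ⟨
        suc h + j + U                        ≤⟨ +-mono-≤ (+-mono-≤ (+-monoˡ-≤ h 1≤h) j≤h*2j) U≤κ ⟩
        h + h + h * (2 * j) + κ              ≡⟨ cong (_+ κ) (regroup₃ h j) ⟩
        h * (2 + 2 * j) + κ                  ∎)
      where
      regroup₁ : ∀ a b → a + (2 + 2 * b) ≡ a + b + (2 + b)
      regroup₁ = solve-∀
      regroup₂ : ∀ a b → a + (2 + b) ≡ suc a + b + 1
      regroup₂ = solve-∀
      regroup₃ : ∀ a b → a + a + a * (2 * b) ≡ a * (2 + 2 * b)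
      regroup₃ = solve-∀
      j≤h*2j : j ≤ h * (2 * j)
      j≤h*2j = ≤-trans (m≤n*m j 2) (m≤n*m (2 * j) h {{>-nonZero 1≤h}})
    ... | inj₂ Σv≤Y with ∃≤-or-sum> y v
    -- Now `U ≤ Y`, and the backward path at `s` weighs at least `Y = X + d`. Then
    -- `Y + U ≤ 2Y = d + (X + Y)`, where `d ≤ h * d` because `h` is positive, and `X + Y ≤ κ`.
    ... | inj₁ (s , y≤v)
      with n , Bn , eq′ ← backward s
         | d , X+d≡Y ← m≤n⇒∃[o]m+o≡n (≤-trans (m+n≤o⇒m≤o X (X+j≤h j eq)) (<⇒≤ h<Y)) =
      reach d Bn
        (begin
          X + d  ≡⟨ X+d≡Y ⟩
          Y      ≡⟨ +-identityʳ Y ⟨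
          Y + 0  ≤⟨ exchange-≤ 0 eq′ y≤v ⟩
          n      ∎)
        (begin
          Y + U          ≤⟨ +-monoʳ-≤ Y (≤-trans (≤-reflexive Σu≡Σv) Σv≤Y) ⟩
          Y + Y          ≡⟨ cong (_+ Y) X+d≡Y ⟨
          X + d + Y      ≡⟨ xy∙z≈y∙xz X d Y ⟩
          d + (X + Y)    ≤⟨ +-mono-≤ (m≤n*m d h {{>-nonZero 1≤h}}) X+Y≤κ ⟩
          h * d + κ      ∎)
    -- If `v s < y s` for all `s`, then `κ + U ≤ Y ≤ κ`, so `U = 0` and `Y = κ`; this is too small
    -- for `Y + U > h + κ`.
    ... | inj₂ κ+Σv≤Y = contradiction h+κ<Y+U (≤⇒≯ (begin
      Y + U        ≡⟨ +-comm Y U ⟩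
      U + Y        ≤⟨ +-monoʳ-≤ U (≤-trans (m≤n+m Y X) X+Y≤κ) ⟩
      U + κ        ≡⟨ cong (_+ κ) Σu≡Σv ⟩
      sum v + κ    ≡⟨ +-comm (sum v) κ ⟩
      κ + sum v    ≤⟨ κ+Σv≤Y ⟩
      Y            ≤⟨ m≤n+m Y X ⟩
      X + Y        ≤⟨ X+Y≤κ ⟩
      κ            ≤⟨ m≤n+m κ h ⟩
      h + κ        ∎))

    reached : Reached
    reached with ∃<-or-sum≥ x u
    ... | inj₂ U≤X = U≤X⇒reached U≤X
    ... | inj₁ (s , x<u) with Y + U ≤? h + κ
    ...   | no  Y+U≰h+κ = h+κ<Y+U⇒reached (≰⇒> Y+U≰h+κ)
    ...   | yes Y+U≤h+κ with n , Bn , eq ← forward s =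
      reach 1 Bn (exchange-≤ 1 eq x<u) (subst (λ d → Y + U ≤ d + κ) (sym (*-identityʳ h)) Y+U≤h+κ)

  -- Reversal and rotation of cyclic indices.

  opposite-inject₁ : ∀ {n} (i : Fin n) → opposite (inject₁ i) ≡ suc (opposite i)
  opposite-inject₁ {suc n} zero    = refl
  opposite-inject₁ {suc n} (suc i) = cong inject₁ (opposite-inject₁ i)

  module _ {n} .{{_ : NonZero n}} where

    -- Translation by `c` on the integers modulo `n`. `shift 1` unfolds to `next`, so the laws below
    -- apply to the steps of a cycle.
    shift : ℕ → Fin n → Fin n
    shift c i = (c + toℕ i) mod n

    toℕ-shift : ∀ c i → toℕ (shift c i) ≡ (c + toℕ i) % n
    toℕ-shift c i = toℕ-fromℕ< (m%n<n (c + toℕ i) n)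

    shift-shift : ∀ c d i → shift c (shift d i) ≡ shift (c + d) i
    shift-shift c d i = toℕ-injective (begin
      toℕ (shift c (shift d i))            ≡⟨ toℕ-shift c (shift d i) ⟩
      (c + toℕ (shift d i)) % n            ≡⟨ cong (λ k → (c + k) % n) (toℕ-shift d i) ⟩
      (c + (d + toℕ i) % n) % n            ≡⟨ %-distribˡ-+ c _ n ⟩
      (c % n + (d + toℕ i) % n % n) % n    ≡⟨ cong (λ k → (c % n + k) % n) (m%n%n≡m%n (d + toℕ i) n) ⟩
      (c % n + (d + toℕ i) % n) % n        ≡⟨ %-distribˡ-+ c (d + toℕ i) n ⟨
      (c + (d + toℕ i)) % n                ≡⟨ cong (_% n) (+-assoc c d (toℕ i)) ⟨
      (c + d + toℕ i) % n                  ≡⟨ toℕ-shift (c + d) i ⟨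
      toℕ (shift (c + d) i)                ∎)
      where open ≡-Reasoning

    shift-n : ∀ i → shift n i ≡ i
    shift-n i = toℕ-injective (begin
      toℕ (shift n i)    ≡⟨ toℕ-shift n i ⟩
      (n + toℕ i) % n    ≡⟨ cong (_% n) (+-comm n (toℕ i)) ⟩
      (toℕ i + n) % n    ≡⟨ [m+n]%n≡m%n (toℕ i) n ⟩
      toℕ i % n          ≡⟨ m<n⇒m%n≡m (toℕ<n i) ⟩
      toℕ i              ∎)
      where open ≡-Reasoning

    rotation : ∀ {c} → c ≤ n → Permutation′ n
    rotation {c} c≤n = permutation (shift c) (shift (n ∸ c))
      (λ i → trans (shift-shift c (n ∸ c) i) (trans (cong (λ d → shift d i) (m+[n∸m]≡n c≤n)) (shift-n i)))
      (λ i → trans (shift-shift (n ∸ c) c i) (trans (cong (λ d → shift d i) (m∸n+n≡m c≤n)) (shift-n i)))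

  permutation-injective : ∀ {n} (π : Permutation′ n) → Injective _≡_ _≡_ (π ⟨$⟩ʳ_)
  permutation-injective π eq = trans (sym (inverseˡ π)) (trans (cong (π ⟨$⟩ˡ_) eq) (inverseˡ π))

  -- Paths obtained from a cycle.

  module _ (G : SimpleGraph) where
    open SimpleGraph G
    open Digraph G

    arc-≡ : ∀ {a b : Arc} → tail a ≡ tail b → head a ≡ head b → a ≡ b
    arc-≡ {arc _ _ _} {arc _ _ _} refl refl = refl

    -- The adjacency stored in an arc is irrelevant; decidability of `_~_` recovers a proof that can
    -- serve as a step of a path.
    arc-adjacent : ∀ a → tail a ~ head a
    arc-adjacent (arc i j i~j) = recompute (i ~? j) i~j

    pathSum : (Arc → ℕ) → ∀ {k} → Path k → ℕ
    pathSum f p = sum (f ∘ Path.arcs p)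

    reversePath : ∀ {k} → Path k → Path k
    reversePath p = record
      { vertex    = vertex ∘ opposite
      ; injective = permutation-injective opposite-permutation ∘ injective
      ; step      = λ t → subst (λ i → vertex i ~ vertex (inject₁ (opposite t)))
                            (sym (opposite-inject₁ t)) (~-sym (step (opposite t)))
      }
      where open Path p

    pathSum-reverse : ∀ (f : Arc → ℕ) {k} (p : Path k) → pathSum f (reversePath p) ≡ pathSum (f ∘ reverse) p
    pathSum-reverse f p = begin
      pathSum f (reversePath p)
        ≡⟨ ℕΣ.sum-cong-≗ (λ t → cong f (arc-≡ (cong (Path.vertex p) (opposite-inject₁ t)) refl)) ⟩
      sum (f ∘ reverse ∘ Path.arcs p ∘ opposite)
        ≡⟨ ℕΣ.sum-permute (f ∘ reverse ∘ Path.arcs p) opposite-permutation ⟨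
      pathSum (f ∘ reverse) p
        ∎
      where open ≡-Reasoning

    -- Paths grow only at the front; growth at the other end is obtained by reversing.
    prepend : ∀ {k} (u : V) (p : Path k) → u ~ Path.vertex p zero → (∀ t → u ≢ Path.vertex p t) → Path (suc k)
    prepend {k} u p u~p₀ u∉p = record { vertex = vertex′ ; injective = injective′ ; step = step′ }
      where
      open Path p
      vertex′ : Fin (suc (suc k)) → V
      vertex′ zero    = u
      vertex′ (suc t) = vertex t
      injective′ : Injective _≡_ _≡_ vertex′
      injective′ {zero}  {zero}  _  = refl
      injective′ {zero}  {suc t} eq = contradiction eq (u∉p t)
      injective′ {suc s} {zero}  eq = contradiction (sym eq) (u∉p s)
      injective′ {suc s} {suc t} eq = cong suc (injective eq)
      step′ : ∀ t → vertex′ (inject₁ t) ~ vertex′ (suc t)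
      step′ zero    = u~p₀
      step′ (suc t) = step t

    module _ {m} (C : Cycle (suc m)) where
      open Cycle C

      private
        κ : ℕ
        κ = suc m

      next-permutation : Permutation′ κ
      next-permutation = rotation (s≤s z≤n)

      module _ (s : Fin κ) where

        -- Renumbers the cycle from `next s` onwards, so that `s` comes last and `arcs s` becomes
        -- the closing arc, the one that `cut` leaves out.
        rotate : Fin κ → Fin κ
        rotate = shift (suc (toℕ s))

        rotate-suc : ∀ t → next (rotate (inject₁ t)) ≡ rotate (suc t)
        rotate-suc t = trans (shift-shift 1 (suc (toℕ s)) (inject₁ t))
          (cong (_mod κ) (trans (cong (suc (suc (toℕ s)) +_) (toℕ-inject₁ t)) (sym (+-suc (suc (toℕ s)) (toℕ t)))))

        rotate-zero : rotate zero ≡ next s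
        rotate-zero = cong (_mod κ) (+-identityʳ (suc (toℕ s)))

        rotate-last : rotate (fromℕ m) ≡ s
        rotate-last = trans (cong (_mod κ) eq) (shift-n s)
          where
          eq : suc (toℕ s) + toℕ (fromℕ m) ≡ κ + toℕ s
          eq = cong suc (trans (cong (toℕ s +_) (toℕ-fromℕ m)) (+-comm (toℕ s) m))

        rotate-permutation : Permutation′ κ
        rotate-permutation = rotation (toℕ<n s)

        cut : Path m
        cut = record
          { vertex    = vertex ∘ rotate
          ; injective = permutation-injective rotate-permutation ∘ injective
          ; step      = λ t → subst (λ i → vertex (rotate (inject₁ t)) ~ vertex i)
                                (rotate-suc t) (step (rotate (inject₁ t)))
          }

        pathSum-cut : ∀ f → pathSum f cut + f (arcs s) ≡ sum (f ∘ arcs)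
        pathSum-cut f = begin
          pathSum f cut + f (arcs s)
            ≡⟨ cong₂ _+_ (ℕΣ.sum-cong-≗ λ t → cong f (arc-≡ refl (cong vertex (sym (rotate-suc t)))))
                         (cong (f ∘ arcs) (sym rotate-last)) ⟩
          sum (f ∘ arcs ∘ rotate ∘ inject₁) + f (arcs (rotate (fromℕ m)))
            ≡⟨ ℕΣ.sum-init-last (f ∘ arcs ∘ rotate) ⟨
          sum (f ∘ arcs ∘ rotate)
            ≡⟨ ℕΣ.sum-permute (f ∘ arcs) rotate-permutation ⟨
          sum (f ∘ arcs) ∎
          where open ≡-Reasoning

      module _ (f : Arc → ℕ) (e : Fin κ → Arc)
        (head-e : ∀ t → head (e t) ≡ vertex t) (tail-e∉C : ∀ t l → tail (e t) ≢ vertex l) where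

        private
          extend : ∀ t (p : Path m) → Path.vertex p zero ≡ vertex t → (∀ l → tail (e t) ≢ Path.vertex p l) →
                   ∃[ q ] pathSum f q ≡ f (e t) + pathSum f p
          extend t p p₀≡ e∉p = prepend (tail (e t)) p (subst (tail (e t) ~_) e⟶p (arc-adjacent (e t))) e∉p
                             , cong (λ a → f a + pathSum f p) (arc-≡ refl (sym e⟶p))
            where
            e⟶p : head (e t) ≡ Path.vertex p zero
            e⟶p = trans (head-e t) (sym p₀≡)

          swap : ∀ {n} a b c {d} → n ≡ a + b → b + c ≡ d → n + c ≡ d + a
          swap a b c refl refl = trans (+-assoc a b c) (+-comm a (b + c))

        -- The cut cycle starts at `next s`, so the arc of `e` entering that vertex can be put in
        -- front.
        forwardPath : ∀ s → ∃[ q ] pathSum f q + f (arcs s) ≡ sum (f ∘ arcs) + f (e (next s))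
        forwardPath s with q , eq ← extend (next s) (cut s) (cong vertex (rotate-zero s)) (λ _ → tail-e∉C _ _) =
          q , swap (f (e (next s))) (pathSum f (cut s)) _ eq (pathSum-cut s f)

        -- Reversed, the cut cycle starts at `s` and runs through the reversed arcs, so the arc of
        -- `e` entering `s` can be put in front.
        backwardPath : ∀ s → ∃[ q ] pathSum f q + f (reverse (arcs s)) ≡ sum (f ∘ reverse ∘ arcs) + f (e s)
        backwardPath s with q , eq ← extend s (reversePath (cut s)) (cong vertex (rotate-last s)) (λ _ → tail-e∉C _ _) =
          q , swap (f (e s)) (pathSum (f ∘ reverse) (cut s)) _
                (trans eq (cong (f (e s) +_) (pathSum-reverse f (cut s)))) (pathSum-cut s (f ∘ reverse))

      2≤κ : 2 ≤ κ
      2≤κ = go m refl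
        where
        go : ∀ n → m ≡ n → 2 ≤ suc n
        -- With a single vertex, `next zero` is `zero`, so the only step would be a loop.
        go zero    refl = contradiction (step zero) (~-irr (vertex zero))
        go (suc n) _    = s≤s (s≤s z≤n)

      -- Two injective listings of the same vertex set differ by a permutation. It allows the added
      -- arcs to be indexed in cyclic order.
      enumeration-permutation : ∀ {v : Fin κ → V} → v Enumerates C → ∃[ π ] ∀ t → v (π ⟨$⟩ʳ t) ≡ vertex t
      enumeration-permutation {v} (v-injective , v⇔C) =
        permutation to from
          (λ k → v-injective (trans (v-to (from k)) (vertex-from k)))
          (λ t → injective (trans (vertex-from (to t)) (v-to t)))
        , v-to
        where
        to from : Fin κ → Fin κ
        to   t = proj₁ (Equivalence.from (v⇔C (vertex t)) (t , refl))
        from k = proj₁ (Equivalence.to (v⇔C (v k)) (k , refl))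
        v-to : ∀ t → v (to t) ≡ vertex t
        v-to t = proj₂ (Equivalence.from (v⇔C (vertex t)) (t , refl))
        vertex-from : ∀ k → vertex (from k) ≡ v k
        vertex-from k = proj₂ (Equivalence.to (v⇔C (v k)) (k , refl))

      -- The count applied to a weighted cycle with inward or outward arcs.

      module _ (f : Arc → ℕ) (f-edge≤1 : ∀ a → f a + f (reverse a) ≤ 1)
        {b} (B : ℕ → Set b) (B-path : ∀ (p : Path κ) → B (pathSum f p)) where

        Bounded : (Fin κ → Arc) → Set b
        Bounded e = ∃[ n ] B n ×
          sum (λ t → ⌊ κ /2⌋ * f (arcs t) + f (reverse (arcs t))) + sum (f ∘ e) ≤ ⌊ κ /2⌋ * n + κ

        private
          f≤1 : ∀ a → f a ≤ 1
          f≤1 a = m+n≤o⇒m≤o (f a) (f-edge≤1 a)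

          count : ∀ {e} (u v : Fin κ → ℕ) → (∀ t → u t ≤ 1) → sum u ≡ sum (f ∘ e) → sum v ≡ sum (f ∘ e) →
            (∀ s → ∃[ n ] B n × n + f (arcs s) ≡ sum (f ∘ arcs) + u s) →
            (∀ s → ∃[ n ] B n × n + f (reverse (arcs s)) ≡ sum (f ∘ reverse ∘ arcs) + v s) →
            Bounded e
          count {e} u v u≤1 Σu≡ Σv≡ fwd bwd
            with n , Bn , le ← Counting.reached (f ∘ arcs) (f ∘ reverse ∘ arcs) u v 2≤κ (f-edge≤1 ∘ arcs)
                                 u≤1 (trans Σu≡ (sym Σv≡)) B fwd bwd =
            n , Bn , ≤-trans (≤-reflexive eq) le
            where
            h = ⌊ κ /2⌋
            open ≡-Reasoning
            eq = begin
              sum (λ t → h * f (arcs t) + f (reverse (arcs t))) + sum (f ∘ e)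
                ≡⟨ cong₂ _+_ (ℕΣ.∑-distrib-+ (λ t → h * f (arcs t)) (f ∘ reverse ∘ arcs)) (sym Σu≡) ⟩
              sum (λ t → h * f (arcs t)) + sum (f ∘ reverse ∘ arcs) + sum u
                ≡⟨ cong (λ k → k + sum (f ∘ reverse ∘ arcs) + sum u) (sym (ℕΣ.*-distribˡ-sum h (f ∘ arcs))) ⟩
              h * sum (f ∘ arcs) + sum (f ∘ reverse ∘ arcs) + sum u
                ≡⟨ +-assoc (h * sum (f ∘ arcs)) _ _ ⟩
              h * sum (f ∘ arcs) + (sum (f ∘ reverse ∘ arcs) + sum u) ∎

          Σ-next : ∀ e → sum (f ∘ e ∘ next) ≡ sum (f ∘ e)
          Σ-next e = sym (ℕΣ.sum-permute (f ∘ e) next-permutation)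

        inward : ∀ e → (∀ t → head (e t) ≡ vertex t) → (∀ t l → tail (e t) ≢ vertex l) → Bounded e
        inward e head-e tail-e∉C = count {e} (f ∘ e ∘ next) (f ∘ e) (f≤1 ∘ e ∘ next) (Σ-next e) refl
          (λ s → let p , eq = forwardPath f e head-e tail-e∉C s in _ , B-path p , eq)
          (λ s → let p , eq = backwardPath f e head-e tail-e∉C s in _ , B-path p , eq)

        -- Reversing all arcs makes the arcs of `e` point inward, so the previous constructions
        -- apply to the weights `f ∘ reverse`. Under these weights the two directions of the cycle
        -- trade places, hence `backwardPath` serves the forward bound and `forwardPath` the
        -- backward one.
        outward : ∀ e → (∀ t → tail (e t) ≡ vertex t) → (∀ t l → head (e t) ≢ vertex l) → Bounded e
        outward e tail-e head-e∉C = count {e} (f ∘ e) (f ∘ e ∘ next) (f≤1 ∘ e) refl (Σ-next e)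
          (λ s → let p , eq = backwardPath (f ∘ reverse) (reverse ∘ e) tail-e head-e∉C s in _ , B-reverse p , eq)
          (λ s → let p , eq = forwardPath (f ∘ reverse) (reverse ∘ e) tail-e head-e∉C s in _ , B-reverse p , eq)
          where
          -- A path weighed by `f ∘ reverse` is turned around to get a path of the same weight under
          -- `f`.
          B-reverse : ∀ p → B (pathSum (f ∘ reverse) p)
          B-reverse p = subst B (pathSum-reverse f p) (B-path (reversePath p))

-- Ordered-field arithmetic and binary values.

module RealProperties {c ℓ₁ ℓ₂} (ℝ : Reals c ℓ₁ ℓ₂) where
  open Reals ℝ
  open CommutativeRing commutativeRing public
    using (refl; sym; trans; ring; semiring; +-cong; +-congˡ; +-congʳ; *-congˡ; *-congʳ; -‿cong;
           +-comm; +-assoc; +-identityˡ; +-identityʳ; *-identityˡ; -‿inverseʳ; -‿inverseˡ; distribˡ;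
           *-commutativeSemigroup)
  open IsTotalOrder isTotalOrder public
    using (total; antisym; isPartialOrder) renaming (reflexive to ≤-reflexive; trans to ≤-trans)
  open RingProperties ring using (-‿distribˡ-*; -‿involutive)
  open SemiringMult semiring using (×1-homo-*; ×-homo-+)
  module ℝΣ = SemiringSum semiring

  poset : Poset c ℓ₁ ℓ₂
  poset = record { isPartialOrder = isPartialOrder }

  module ≤-Reasoning = PosetReasoning poset
  open ≤-Reasoning

  +-mono-≤ : ∀ {x y u v} → x ≤ y → u ≤ v → x + u ≤ y + v
  +-mono-≤ {x} {y} {u} {v} x≤y u≤v = begin
    x + u  ≤⟨ +-monoʳ-≤ x u≤v ⟩
    x + v  ≈⟨ +-comm x v ⟩
    v + x  ≤⟨ +-monoʳ-≤ v x≤y ⟩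
    v + y  ≈⟨ +-comm v y ⟩
    y + v  ∎

  x≤y+z⇒x-z≤y : ∀ {x y z} → x ≤ y + z → x - z ≤ y
  x≤y+z⇒x-z≤y {x} {y} {z} x≤y+z = begin
    x - z        ≤⟨ +-mono-≤ x≤y+z (≤-reflexive refl) ⟩
    y + z - z    ≈⟨ +-assoc y z (- z) ⟩
    y + (z - z)  ≈⟨ +-congˡ (-‿inverseʳ z) ⟩
    y + 0#       ≈⟨ +-identityʳ y ⟩
    y            ∎

  x≤y⇒0≤y-x : ∀ {x y} → x ≤ y → 0# ≤ y - x
  x≤y⇒0≤y-x {x} {y} x≤y = begin
    0#     ≈⟨ -‿inverseʳ x ⟨
    x - x  ≤⟨ +-mono-≤ x≤y (≤-reflexive refl) ⟩
    y - x  ∎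

  *-monoʳ-≤ : ∀ {x y z} → 0# ≤ x → y ≤ z → x * y ≤ x * z
  *-monoʳ-≤ {x} {y} {z} 0≤x y≤z = begin
    x * y                    ≈⟨ +-identityʳ _ ⟨
    x * y + 0#               ≤⟨ +-monoʳ-≤ _ (*-nonNegative 0≤x (x≤y⇒0≤y-x y≤z)) ⟩
    x * y + x * (z - y)      ≈⟨ distribˡ x y (z - y) ⟨
    x * (y + (z - y))        ≈⟨ *-congˡ (+-comm y (z - y)) ⟩
    x * (z - y + y)          ≈⟨ *-congˡ (+-assoc z (- y) y) ⟩
    x * (z + (- y + y))      ≈⟨ *-congˡ (+-congˡ (-‿inverseˡ y)) ⟩
    x * (z + 0#)             ≈⟨ *-congˡ (+-identityʳ z) ⟩
    x * z                    ∎

  -- If instead `1# ≤ 0#`, then `- 1#` is nonnegative, and so is its square, which is `1#`.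
  0≤1 : 0# ≤ 1#
  0≤1 with total 0# 1#
  ... | inj₁ 0≤1 = 0≤1
  ... | inj₂ 1≤0 = begin
    0#             ≤⟨ *-nonNegative 0≤-1 0≤-1 ⟩
    - 1# * - 1#    ≈⟨ -‿distribˡ-* 1# (- 1#) ⟨
    - (1# * - 1#)  ≈⟨ -‿cong (*-identityˡ (- 1#)) ⟩
    - - 1#         ≈⟨ -‿involutive 1# ⟩
    1#             ∎
    where
    0≤-1 : 0# ≤ - 1#
    0≤-1 = ≤-trans (x≤y⇒0≤y-x 1≤0) (≤-reflexive (+-identityˡ (- 1#)))

  fromℕ-+ : ∀ m n → fromℕ (m ℕ.+ n) ≈ fromℕ m + fromℕ n
  fromℕ-+ = ×-homo-+ 1#

  fromℕ-* : ∀ m n → fromℕ (m ℕ.* n) ≈ fromℕ m * fromℕ n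
  fromℕ-* = ×1-homo-*

  fromℕ-sum : ∀ {n} (f : Fin n → ℕ) → fromℕ (ℕΣ.sum f) ≈ sum (fromℕ ∘ f)
  fromℕ-sum {zero}  f = refl
  fromℕ-sum {suc n} f = trans (fromℕ-+ (f zero) _) (+-congˡ (fromℕ-sum (f ∘ suc)))

  0≤fromℕ : ∀ n → 0# ≤ fromℕ n
  0≤fromℕ zero    = ≤-reflexive refl
  0≤fromℕ (suc n) = ≤-trans (≤-reflexive (sym (+-identityˡ 0#))) (+-mono-≤ 0≤1 (0≤fromℕ n))

  fromℕ-mono-≤ : ∀ {m n} → m ℕ.≤ n → fromℕ m ≤ fromℕ n
  fromℕ-mono-≤ {n = n} z≤n = 0≤fromℕ n
  fromℕ-mono-≤ (s≤s m≤n)   = +-monoʳ-≤ 1# (fromℕ-mono-≤ m≤n)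

  sum-mono : ∀ {n} {f g : Fin n → Carrier} → (∀ i → f i ≤ g i) → sum f ≤ sum g
  sum-mono {zero}  f≤g = ≤-reflexive refl
  sum-mono {suc n} f≤g = +-mono-≤ (f≤g zero) (sum-mono (f≤g ∘ suc))

  2≰1 : ¬ (1# + 1# ≤ 1#)
  2≰1 2≤1 = 0≉1 (antisym 0≤1 (begin
    1#              ≈⟨ +-identityʳ 1# ⟨
    1# + 0#         ≈⟨ +-congˡ (-‿inverseʳ 1#) ⟨
    1# + (1# - 1#)  ≈⟨ +-assoc 1# 1# (- 1#) ⟨
    1# + 1# - 1#    ≤⟨ x≤y+z⇒x-z≤y (≤-trans 2≤1 (≤-reflexive (sym (+-identityˡ 1#)))) ⟩
    0#              ∎))

  Bit : Carrier → Set _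
  Bit x = x ≈ 0# ⊎ x ≈ 1#

  -- The natural number is read off the proof that `x` is binary, not off `x` itself.
  bit : ∀ {x} → Bit x → ℕ
  bit (inj₁ _) = 0
  bit (inj₂ _) = 1

  fromℕ-bit : ∀ {x} (b : Bit x) → fromℕ (bit b) ≈ x
  fromℕ-bit (inj₁ x≈0) = sym x≈0
  fromℕ-bit (inj₂ x≈1) = trans (+-identityʳ 1#) (sym x≈1)

  bit+bit≤1 : ∀ {x y} (b : Bit x) (b′ : Bit y) → x + y ≤ 1# → bit b ℕ.+ bit b′ ℕ.≤ 1
  bit+bit≤1 (inj₁ _) (inj₁ _) _ = z≤n
  bit+bit≤1 (inj₁ _) (inj₂ _) _ = s≤s z≤n
  bit+bit≤1 (inj₂ _) (inj₁ _) _ = s≤s z≤n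
  bit+bit≤1 (inj₂ x≈1) (inj₂ y≈1) x+y≤1 =
    contradiction (≤-trans (≤-reflexive (+-cong (sym x≈1) (sym y≈1))) x+y≤1) 2≰1

module _ {c ℓ₁ ℓ₂} (ℝ : Reals c ℓ₁ ℓ₂) (G : SimpleGraph) where
  open Reals ℝ
  open RealProperties ℝ
  open SimpleGraph G
  open Digraph G
  open Polytope ℝ G
  open ≤-Reasoning

  -- Affine functions on a convex hull.

  module _ {ℓ} {S : Point → Set ℓ} {x : Point} (x∈hull : ConvexHull S x) where
    open ConvexHull x∈hull

    -- Compatibility with the one convex combination that represents `x`, which is all that
    -- comparing values at `x` requires.
    Affine : (Point → Carrier) → Set ℓ₁
    Affine L = L x ≈ sum (λ t → weight t * L (point t))

    affine-const : ∀ a → Affine (λ _ → a)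
    affine-const a = begin-equality
      a                           ≈⟨ *-identityˡ a ⟨
      1# * a                      ≈⟨ *-congʳ sum≈1 ⟨
      sum weight * a              ≈⟨ ℝΣ.*-distribʳ-sum a weight ⟩
      sum (λ t → weight t * a)    ∎

    affine-+ : ∀ {L M} → Affine L → Affine M → Affine (λ p → L p + M p)
    affine-+ {L} {M} L-affine M-affine = begin-equality
      L x + M x                                             ≈⟨ +-cong L-affine M-affine ⟩
      sum (λ t → weight t * L (point t)) + sum (λ t → weight t * M (point t))
        ≈⟨ ℝΣ.∑-distrib-+ (λ t → weight t * L (point t)) (λ t → weight t * M (point t)) ⟨
      sum (λ t → weight t * L (point t) + weight t * M (point t))
        ≈⟨ ℝΣ.sum-cong-≋ (λ t → distribˡ (weight t) (L (point t)) (M (point t))) ⟨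
      sum (λ t → weight t * (L (point t) + M (point t)))    ∎

    affine-* : ∀ a {L} → Affine L → Affine (λ p → a * L p)
    affine-* a {L} L-affine = begin-equality
      a * L x                                       ≈⟨ *-congˡ L-affine ⟩
      a * sum (λ t → weight t * L (point t))        ≈⟨ ℝΣ.*-distribˡ-sum a (λ t → weight t * L (point t)) ⟩
      sum (λ t → a * (weight t * L (point t)))      ≈⟨ ℝΣ.sum-cong-≋ (λ t → x∙yz≈y∙xz a (weight t) (L (point t))) ⟩
      sum (λ t → weight t * (a * L (point t)))      ∎
      where open CommutativeSemigroupProperties *-commutativeSemigroup using (x∙yz≈y∙xz)

    affine-sum : ∀ {n} {L : Fin n → Point → Carrier} → (∀ i → Affine (L i)) → Affine (λ p → sum (λ i → L i p))
    affine-sum {zero}  L-affine = affine-const 0#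
    affine-sum {suc n} L-affine = affine-+ (L-affine zero) (affine-sum (L-affine ∘ suc))

    -- Nonnegative weights preserve the inequality at each point of the combination.
    hull-≤ : ∀ {L M} → Affine L → Affine M → (∀ p → S p → L p ≤ M p) → L x ≤ M x
    hull-≤ {L} {M} L-affine M-affine L≤M = begin
      L x                                  ≈⟨ L-affine ⟩
      sum (λ t → weight t * L (point t))   ≤⟨ sum-mono (λ t → *-monoʳ-≤ (nonNegative t) (L≤M _ (point∈S t))) ⟩
      sum (λ t → weight t * M (point t))   ≈⟨ M-affine ⟨
      M x                                  ∎

  -- From feasible points to the polytope.

  module _ {m} (C : Cycle (suc m)) {v : Fin (suc m) → V} (v-enumerates-C : v Enumerates C)
    {r : Fin (suc m) → V} {e : Fin (suc m) → Arc} (r∉C : ∀ k l → r k ≢ v l)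
    (e-orientation : (∀ k → e k isArc r k ⟶ v k) ⊎ (∀ k → e k isArc v k ⟶ r k)) where
    open Cycle C

    private
      κ h : ℕ
      κ = suc m
      h = ⌊ κ /2⌋

    lhs : Point → Carrier
    lhs x = sum (λ t → fromℕ h * w x (arcs t) + w x (reverse (arcs t))) + sum (λ k → w x (e k))

    feasible-≤ : ∀ x → Feasible κ x → lhs x ≤ fromℕ h * z x + fromℕ κ
    feasible-≤ x x-feasible = let n , n≤z , le = bounded in begin
      lhs x
        ≈⟨ +-cong (ℝΣ.sum-cong-≋ g≈) (ℝΣ.sum-cong-≋ (f≈w ∘ e)) ⟨
      sum (fromℕ ∘ g) + sum (fromℕ ∘ f ∘ e)
        ≈⟨ +-cong (fromℕ-sum g) (fromℕ-sum (f ∘ e)) ⟨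
      fromℕ (ℕΣ.sum g) + fromℕ (ℕΣ.sum (f ∘ e))
        ≈⟨ fromℕ-+ (ℕΣ.sum g) (ℕΣ.sum (f ∘ e)) ⟨
      fromℕ (ℕΣ.sum g ℕ.+ ℕΣ.sum (f ∘ e))
        ≤⟨ fromℕ-mono-≤ le ⟩
      fromℕ (h ℕ.* n ℕ.+ κ)
        ≈⟨ trans (fromℕ-+ (h ℕ.* n) κ) (+-congʳ (fromℕ-* h n)) ⟩
      fromℕ h * fromℕ n + fromℕ κ
        ≤⟨ +-mono-≤ (*-monoʳ-≤ (0≤fromℕ h) n≤z) (≤-reflexive refl) ⟩
      fromℕ h * z x + fromℕ κ ∎
      where
      open Feasible x-feasible
      f : Arc → ℕ
      f a = bit (binary a)
      f≈w : ∀ a → fromℕ (f a) ≈ w x a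
      f≈w a = fromℕ-bit (binary a)
      g : Fin κ → ℕ
      g t = h ℕ.* f (arcs t) ℕ.+ f (reverse (arcs t))
      g≈ : ∀ t → fromℕ (g t) ≈ fromℕ h * w x (arcs t) + w x (reverse (arcs t))
      g≈ t = begin-equality
        fromℕ (g t)
          ≈⟨ fromℕ-+ (h ℕ.* f (arcs t)) (f (reverse (arcs t))) ⟩
        fromℕ (h ℕ.* f (arcs t)) + fromℕ (f (reverse (arcs t)))
          ≈⟨ +-cong (trans (fromℕ-* h (f (arcs t))) (*-congˡ (f≈w (arcs t)))) (f≈w (reverse (arcs t))) ⟩
        fromℕ h * w x (arcs t) + w x (reverse (arcs t)) ∎
      edge : ∀ a → f a ℕ.+ f (reverse a) ℕ.≤ 1
      edge a = bit+bit≤1 (binary a) (binary (reverse a)) (edge≤1 a)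
      -- This is the predicate `B` of the count; the path constraints of the polytope place every
      -- path weight below `z`.
      Below : ℕ → Set _
      Below n = fromℕ n ≤ z x
      path : ∀ p → Below (pathSum G f p)
      path p = ≤-trans
        (≤-reflexive (trans (fromℕ-sum (f ∘ Path.arcs p)) (ℝΣ.sum-cong-≋ (f≈w ∘ Path.arcs p)))) (path≤z p)
      bounded : Bounded G C f edge Below path e
      bounded with π , vπ≡c ← enumeration-permutation G C v-enumerates-C = go e-orientation
        where
        -- The count needs `e` aligned with the cyclic order, whereas `v` may list the vertices in
        -- any order. Only the total weight of `e` enters the conclusion, and reindexing by `π`
        -- preserves it.
        unpermute : Bounded G C f edge Below path (e ∘ (π ⟨$⟩ʳ_)) → Bounded G C f edge Below path e
        unpermute (n , n≤z , le) = n , n≤z ,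
          ≡.subst (λ k → ℕΣ.sum g ℕ.+ k ℕ.≤ h ℕ.* n ℕ.+ κ) (≡.sym (ℕΣ.sum-permute (f ∘ e) π)) le
        r≢c : ∀ {u k} → u ≡ r k → ∀ l → u ≢ vertex l
        r≢c u≡r l u≡c = r∉C _ _ (≡.trans (≡.sym u≡r) (≡.trans u≡c (≡.sym (vπ≡c l))))
        go : _ → Bounded G C f edge Below path e
        go (inj₁ e-in)  = unpermute (inward G C f edge Below path (e ∘ (π ⟨$⟩ʳ_))
          (λ t → ≡.trans (proj₂ (e-in _)) (vπ≡c t)) (λ t → r≢c (proj₁ (e-in (π ⟨$⟩ʳ t)))))
        go (inj₂ e-out) = unpermute (outward G C f edge Below path (e ∘ (π ⟨$⟩ʳ_))
          (λ t → ≡.trans (proj₁ (e-out _)) (vπ≡c t)) (λ t → r≢c (proj₂ (e-out (π ⟨$⟩ʳ t)))))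

    inequality : Valid κ (λ x → lhs x - fromℕ κ) (λ x → fromℕ h * z x)
    inequality x x∈P = x≤y+z⇒x-z≤y (hull-≤ x∈P lhs-affine rhs-affine feasible-≤)
      where
      open ConvexHull x∈P
      lhs-affine : Affine x∈P lhs
      lhs-affine = affine-+ x∈P
        (affine-sum x∈P {L = λ t p → fromℕ h * w p (arcs t) + w p (reverse (arcs t))} λ t →
          affine-+ x∈P (affine-* x∈P (fromℕ h) {λ p → w p (arcs t)} (w-combines (arcs t))) (w-combines (reverse (arcs t))))
        (affine-sum x∈P {L = λ k p → w p (e k)} λ k → w-combines (e k))
      rhs-affine : Affine x∈P (λ p → fromℕ h * z p + fromℕ κ)
      rhs-affine = affine-+ x∈P (affine-* x∈P (fromℕ h) {z} z-combines) (affine-const x∈P (fromℕ κ))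

theorem10 : ∀ {c ℓ₁ ℓ₂} (ℝ : Reals c ℓ₁ ℓ₂) (G : SimpleGraph) (κ : ℕ) .{{_ : NonZero κ}} →
  let open Reals ℝ
      open SimpleGraph G using (V)
      open Digraph G
      open Polytope ℝ G
  in
  (C : Cycle κ) (v : Fin κ → V) → v Enumerates C →
  (r : Fin κ → V) (e : Fin κ → Arc) →
  (∀ k l → r k ≢ v l) →
  ((∀ k → e k isArc r k ⟶ v k) ⊎ (∀ k → e k isArc v k ⟶ r k)) →
  Valid κ
    (λ x → sum (λ t → fromℕ ⌊ κ /2⌋ * w x (Cycle.arcs C t) + w x (reverse (Cycle.arcs C t)))
           + sum (λ k → w x (e k)) - fromℕ κ)
    (λ x → fromℕ ⌊ κ /2⌋ * z x)
theorem10 ℝ G zero    {{κ≢0}} = contradiction-irr κ≢0 λ ()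
theorem10 ℝ G (suc m) C v v-enumerates-C r e r∉C e-orientation =
  inequality ℝ G C v-enumerates-C {r} {e} r∉C e-orientation
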